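{- For every integer $n\ge 3$, the cycle $C_n$ on $n$ vertices satisfies \[ \operatorname{st}_{\gamma_{st}}(C_n)=\begin{cases}1,& \text{if } n\equiv 1 \pmod 3,\\ 2,& \text{if } n\equiv 2 \pmod 3,\\ 3,& \text{if } n\equiv 0 \pmod 3.\end{cases} \]
   Context: All graphs are finite, simple and undirected. For a graph $G=(V,E)$, a set $D\subseteq V$ is a strong dominating set if every vertex $v\in V\setminus D$ is adjacent to some $u\in D$ with $\deg(v)\le\deg(u)$ (degrees taken in $G$). The strong domination number $\gamma_{st}(G)$ is the minimum size of a strong dominating set; the graph with no vertices has $\gamma_{st}=0$. For $S\subseteq V$, $G-S$ is the graph obtained by deleting the vertices of $S$. The stability of the strong domination number is $\operatorname{st}_{\gamma_{st}}(G)=\min\{|S| : S\subseteq V,\ \gamma_{st}(G-S)\ne\gamma_{st}(G)\}$ (the choice $S=V$ is allowed). -}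

module Defs where

open import Data.Empty using (⊥-elim)
open import Data.Fin.Base using (Fin; zero; suc; toℕ; fromℕ<)
open import Data.Fin.Properties using (any?; all?)
open import Data.Fin.Subset
  using (Subset; inside; outside; _∈_; _∉_; _⊆_; _─_; ∣_∣; ⊥; ⊤; Nonempty)
open import Data.Fin.Subset.Properties
  using (_∈?_; _⊆?_; anySubset?; ∈⊤; ⊥⊆; ∣⊥∣≡0; ⊆-refl; x∈p∧x∉q⇒x∈p─q)
open import Data.Nat.Base using (ℕ; suc; _≤_; _<_; z≤n; s≤s)
open import Data.Nat.Induction using (<-rec)
open import Data.Nat.Properties
  using (_≟_; _≤?_; _<?_; ≮⇒≥; n≤0⇒n≡0; 1+n≢n; <-≤-trans)
open import Data.Product.Base using (∃; _×_; _,_; proj₁; proj₂)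
open import Data.Sum.Base using (_⊎_; inj₁; inj₂; swap)
open import Data.Vec.Base using (tabulate; _∷_; here; there)
open import Level using (0ℓ)
open import Relation.Binary.Core using (Rel)
open import Relation.Binary.PropositionalEquality
  using (_≡_; _≢_; refl; sym; trans; subst)
import Relation.Binary.Definitions as B
open import Relation.Nullary using (¬_; yes; no; does)
open import Relation.Nullary.Decidable using (¬?; _×-dec_; _⊎-dec_; _→-dec_)
open import Relation.Unary using (Decidable)

-- A finite simple graph whose vertex set is a subset of Fin N. Keeping the
-- ambient Fin N fixed lets vertex deletion leave the vertex names unchanged.
record Graph (N : ℕ) : Set₁ where
  field
    V          : Subset N
    Adj        : Rel (Fin N) 0ℓ
    adj?       : B.Decidable Adj
    adj-sym    : ∀ {u v} → Adj u v → Adj v u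
    adj-irrefl : ∀ {v} → ¬ Adj v v
    adj⇒∈V     : ∀ {u v} → Adj u v → u ∈ V

  neighbours : Fin N → Subset N
  neighbours v = tabulate (λ u → does (adj? v u))

  deg : Fin N → ℕ
  deg v = ∣ neighbours v ∣

open Graph

infixl 5 _-ᵍ_

_-ᵍ_ : ∀ {N} → Graph N → Subset N → Graph N
G -ᵍ S = record
  { V          = V G ─ S
  ; Adj        = λ u v → Adj G u v × u ∉ S × v ∉ S
  ; adj?       = λ u v → adj? G u v ×-dec (¬? (u ∈? S) ×-dec ¬? (v ∈? S))
  ; adj-sym    = λ (a , u∉S , v∉S) → adj-sym G a , v∉S , u∉S
  ; adj-irrefl = λ (a , _) → adj-irrefl G a
  ; adj⇒∈V     = λ (a , u∉S , _) → x∈p∧x∉q⇒x∈p─q (adj⇒∈V G a) u∉S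
  }

IsMinSize : ∀ {N} → (Subset N → Set) → ℕ → Set
IsMinSize P k = (∃ λ S → P S × ∣ S ∣ ≡ k) × (∀ S → P S → k ≤ ∣ S ∣)

minSize : ∀ {N} {P : Subset N → Set} → Decidable P → ∃ P → ∃ (IsMinSize P)
minSize {N} {P} P? (S₀ , pS₀) =
  <-rec (λ k → ∀ S → P S → ∣ S ∣ ≡ k → ∃ (IsMinSize P)) step ∣ S₀ ∣ S₀ pS₀ refl
  where
  step : ∀ k → (∀ {j} → j < k → ∀ S → P S → ∣ S ∣ ≡ j → ∃ (IsMinSize P)) →
         ∀ S → P S → ∣ S ∣ ≡ k → ∃ (IsMinSize P)
  step k rec S pS eq with anySubset? (λ T → P? T ×-dec (∣ T ∣ <? k))
  ... | yes (T , pT , T<k) = rec T<k T pT refl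
  ... | no ¬smaller = k , (S , pS , eq) , λ T pT → ≮⇒≥ (λ T<k → ¬smaller (T , pT , T<k))

IsStrongDominating : ∀ {N} → Graph N → Subset N → Set
IsStrongDominating G D =
  D ⊆ V G ×
  (∀ v → v ∈ V G → v ∉ D → ∃ λ u → u ∈ D × Adj G v u × deg G v ≤ deg G u)

isStrongDominating? : ∀ {N} (G : Graph N) → Decidable (IsStrongDominating G)
isStrongDominating? G D =
  (D ⊆? V G) ×-dec
  all? (λ v → (v ∈? V G) →-dec (¬? (v ∈? D) →-dec
    any? (λ u → (u ∈? D) ×-dec (adj? G v u ×-dec (deg G v ≤? deg G u)))))

V-isStrongDominating : ∀ {N} (G : Graph N) → IsStrongDominating G (V G)
V-isStrongDominating G = ⊆-refl , λ v v∈V v∉V → ⊥-elim (v∉V v∈V)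

γst-min : ∀ {N} (G : Graph N) → ∃ (IsMinSize (IsStrongDominating G))
γst-min G = minSize (isStrongDominating? G) (V G , V-isStrongDominating G)

γst : ∀ {N} → Graph N → ℕ
γst G = proj₁ (γst-min G)

ChangesγSt : ∀ {N} → Graph N → Subset N → Set
ChangesγSt G S = S ⊆ V G × γst (G -ᵍ S) ≢ γst G

changesγSt? : ∀ {N} (G : Graph N) → Decidable (ChangesγSt G)
changesγSt? G S = (S ⊆? V G) ×-dec ¬? (γst (G -ᵍ S) ≟ γst G)

x∉p─p : ∀ {N} (p : Subset N) {x} → x ∉ p ─ p
x∉p─p (inside  ∷ p) {zero}  ()
x∉p─p (outside ∷ p) {zero}  ()
x∉p─p (_       ∷ p) {suc x} (there x∈) = x∉p─p p x∈

∣p∣≡0⇒x∉p : ∀ {N} (p : Subset N) {x} → ∣ p ∣ ≡ 0 → x ∉ p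
∣p∣≡0⇒x∉p (outside ∷ p) eq (there x∈) = ∣p∣≡0⇒x∉p p eq x∈

γst-null : ∀ {N} (G : Graph N) → γst (G -ᵍ V G) ≡ 0
γst-null {N} G = n≤0⇒n≡0 (subst (γst (G -ᵍ V G) ≤_) (∣⊥∣≡0 N)
  (proj₂ (proj₂ (γst-min (G -ᵍ V G))) ⊥
    (⊥⊆ , λ v v∈ _ → ⊥-elim (x∉p─p (V G) v∈))))

γst≢0 : ∀ {N} (G : Graph N) → Nonempty (V G) → γst G ≢ 0
γst≢0 G (v , v∈V) γ≡0 with proj₁ (proj₂ (γst-min G))
... | D , (_ , dom) , ∣D∣≡γ =
  let D∌ = λ {x} → ∣p∣≡0⇒x∉p D {x} (trans ∣D∣≡γ γ≡0)
  in  D∌ (proj₁ (proj₂ (dom v v∈V D∌)))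

V-changesγSt : ∀ {N} (G : Graph N) → Nonempty (V G) → ChangesγSt G (V G)
V-changesγSt G ne = ⊆-refl , λ eq → γst≢0 G ne (trans (sym eq) (γst-null G))

st-min : ∀ {N} (G : Graph N) → Nonempty (V G) → ∃ (IsMinSize (ChangesγSt G))
st-min G ne = minSize (changesγSt? G) (V G , V-changesγSt G ne)

-- For the graph with no vertices the minimum is over the empty set, hence the
-- nonemptiness argument.
st : ∀ {N} (G : Graph N) → Nonempty (V G) → ℕ
st G ne = proj₁ (st-min G ne)

-- v is the successor of u in the cyclic order 0, 1, …, n - 1, 0.
Next : ∀ {n} → Rel (Fin n) 0ℓ
Next {n} u v = suc (toℕ u) ≡ toℕ v ⊎ (suc (toℕ u) ≡ n × toℕ v ≡ 0)

next? : ∀ {n} → B.Decidable (Next {n})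
next? {n} u v = (suc (toℕ u) ≟ toℕ v) ⊎-dec ((suc (toℕ u) ≟ n) ×-dec (toℕ v ≟ 0))

next-irrefl : ∀ {n} → 3 ≤ n → ∀ {v : Fin n} → ¬ Next v v
next-irrefl _ (inj₁ eq) = 1+n≢n eq
next-irrefl 3≤n {v} (inj₂ (eq , v≡0)) with toℕ v
next-irrefl (s≤s ()) (inj₂ (refl , refl)) | .0

cycle : ∀ n → 3 ≤ n → Graph n
cycle n 3≤n = record
  { V          = ⊤
  ; Adj        = λ u v → Next u v ⊎ Next v u
  ; adj?       = λ u v → next? u v ⊎-dec next? v u
  ; adj-sym    = swap
  ; adj-irrefl = λ { (inj₁ p) → next-irrefl 3≤n p ; (inj₂ p) → next-irrefl 3≤n p }
  ; adj⇒∈V     = λ _ → ∈⊤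
  }

cycle-nonempty : ∀ n (3≤n : 3 ≤ n) → Nonempty (V (cycle n 3≤n))
cycle-nonempty n 3≤n = fromℕ< (<-≤-trans (s≤s z≤n) 3≤n) , ∈⊤

{-# OPTIONS --safe #-}
module Submission where

-- Write n = r + 3q with 1 ≤ r ≤ 3; the claim is that the stability is r.
-- All degrees in Cₙ - S are at most 2, so a vertex dominates at most three vertices
-- and n ≤ |S| + 3γ. Conversely, starting just after a vertex of S and cutting the
-- remaining vertices greedily into blocks of at most three consecutive ones, each
-- dominated by one of its vertices, gives 3γ ≤ n + |S|. For |S| < r the two bounds
-- force γ = q + 1, whereas deleting r consecutive vertices leaves a path on 3q
-- vertices, for which q blocks suffice.

open import Defs
open import Data.Bool.Base using (if_then_else_)
open import Data.Fin.Base using (Fin; zero; suc; toℕ)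
open import Data.Fin.Properties using (toℕ-injective; toℕ<n; toℕ-fromℕ<)
open import Data.Fin.Subset
  using (Subset; inside; outside; Nonempty; _∈_; _∉_; _⊆_; _∪_; _─_; ∣_∣; ⁅_⁆; ⊤; ⊥)
open import Data.Fin.Subset.Properties
open import Data.Nat using (ℕ; zero; suc; _+_; _*_; _/_; _%_; _≤_; _<_; z≤n; s≤s; pred; NonZero; >-nonZero)
open import Data.Nat.DivMod
  using (_mod_; [m+kn]%n≡m%n; [m+n]%n≡m%n; n%n≡0; m%n<n; m<n⇒m%n≡m; m≡m%n+[m/n]*n)
open import Data.Nat.Properties
open import Data.Nat.Tactic.RingSolver using (solve-∀)
open import Data.Product using (_×_; _,_; proj₁; proj₂; ∃)
open import Data.Sum using (_⊎_; inj₁; inj₂; [_,_]′)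
open import Data.Vec.Base using ([]; _∷_; here; there)
open import Data.Vec.Properties using (lookup∘tabulate; lookup⇒[]=; []=⇒lookup)
open import Function using (_∘_)
open import Relation.Binary.PropositionalEquality
  using (_≡_; _≢_; refl; sym; trans; cong; cong₂; subst)
open import Relation.Nullary using (¬_; Dec; yes; no; does; contradiction)
open import Relation.Nullary.Decidable using (dec-true)

open Graph

-- Finite sets

∣p∪q∣≤∣p∣+∣q∣ : ∀ {n} (p q : Subset n) → ∣ p ∪ q ∣ ≤ ∣ p ∣ + ∣ q ∣
∣p∪q∣≤∣p∣+∣q∣ []            []            = z≤n
∣p∪q∣≤∣p∣+∣q∣ (outside ∷ p) (outside ∷ q) = ∣p∪q∣≤∣p∣+∣q∣ p q
∣p∪q∣≤∣p∣+∣q∣ (outside ∷ p) (inside ∷ q)  =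
  subst (suc ∣ p ∪ q ∣ ≤_) (sym (+-suc ∣ p ∣ ∣ q ∣)) (s≤s (∣p∪q∣≤∣p∣+∣q∣ p q))
∣p∪q∣≤∣p∣+∣q∣ (inside ∷ p)  (outside ∷ q) = s≤s (∣p∪q∣≤∣p∣+∣q∣ p q)
∣p∪q∣≤∣p∣+∣q∣ (inside ∷ p)  (inside ∷ q)  =
  s≤s (≤-trans (∣p∪q∣≤∣p∣+∣q∣ p q) (+-monoʳ-≤ ∣ p ∣ (n≤1+n ∣ q ∣)))

∣⁅x⁆∪p∣≤1+∣p∣ : ∀ {n} (x : Fin n) p → ∣ ⁅ x ⁆ ∪ p ∣ ≤ suc ∣ p ∣
∣⁅x⁆∪p∣≤1+∣p∣ x p =
  subst (λ m → ∣ ⁅ x ⁆ ∪ p ∣ ≤ m + ∣ p ∣) (∣⁅x⁆∣≡1 x) (∣p∪q∣≤∣p∣+∣q∣ ⁅ x ⁆ p)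

x∈p─q⇒x∉q : ∀ {n} (p q : Subset n) {x} → x ∈ p ─ q → x ∉ q
x∈p─q⇒x∉q (inside  ∷ _) (outside ∷ _) here       ()
x∈p─q⇒x∉q (_       ∷ p) (_       ∷ q) (there x∈) (there x∈q) = x∈p─q⇒x∉q p q x∈ x∈q

x∈p⇒1≤∣p∣ : ∀ {n} {p : Subset n} {x} → x ∈ p → 1 ≤ ∣ p ∣
x∈p⇒1≤∣p∣ x∈p = ≤-trans (s≤s z≤n) (x∈p⇒∣p-x∣<∣p∣ x∈p)

x≢y⇒2≤∣p∣ : ∀ {n} {p : Subset n} {x y} → x ∈ p → y ∈ p → x ≢ y → 2 ≤ ∣ p ∣
x≢y⇒2≤∣p∣ x∈p y∈p x≢y =
  ≤-trans (s≤s (x∈p⇒1≤∣p∣ (x∈p∧x≢y⇒x∈p-y x∈p x≢y))) (x∈p⇒∣p-x∣<∣p∣ y∈p)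

initial : ℕ → ∀ {n} → Subset n
initial _       {zero}  = []
initial zero    {suc n} = outside ∷ initial zero
initial (suc r) {suc n} = inside ∷ initial r

∣initial∣≤ : ∀ r {n} → ∣ initial r {n} ∣ ≤ r
∣initial∣≤ _       {zero}  = z≤n
∣initial∣≤ zero    {suc n} = ∣initial∣≤ zero {n}
∣initial∣≤ (suc r) {suc n} = s≤s (∣initial∣≤ r {n})

∈-initial⁺ : ∀ {r n : ℕ} {v : Fin n} → toℕ v < r → v ∈ initial r
∈-initial⁺ {suc r} {v = zero}  _         = here
∈-initial⁺ {suc r} {v = suc v} (s≤s v<r) = there (∈-initial⁺ v<r)

∈-initial⁻ : ∀ {r n : ℕ} {v : Fin n} → v ∈ initial r → toℕ v < r
∈-initial⁻ {zero}  {v = suc v} (there v∈) = contradiction (∈-initial⁻ v∈) λ ()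
∈-initial⁻ {suc r} {v = zero}  _          = s≤s z≤n
∈-initial⁻ {suc r} {v = suc v} (there v∈) = s≤s (∈-initial⁻ v∈)

-- Counting

sum : (ℕ → ℕ) → ℕ → ℕ → ℕ
sum g i zero    = 0
sum g i (suc m) = g i + sum g (suc i) m

sum-last : ∀ g i m → sum g i (suc m) ≡ sum g i m + g (m + i)
sum-last g i zero    = +-identityʳ (g i)
sum-last g i (suc m) = begin
  g i + sum g (suc i) (suc m)             ≡⟨ cong (g i +_) (sum-last g (suc i) m) ⟩
  g i + (sum g (suc i) m + g (m + suc i)) ≡⟨ +-assoc (g i) _ _ ⟨
  g i + sum g (suc i) m + g (m + suc i)   ≡⟨ cong (λ j → sum g i (suc m) + g j) (+-suc m i) ⟩
  sum g i (suc m) + g (suc m + i)         ∎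
  where open Relation.Binary.PropositionalEquality.≡-Reasoning

-- Moving the window one place forward drops `g i` and gains `g (n + i)`, which are equal by
-- periodicity.
sum-periodic : ∀ g n → (∀ j → g (n + j) ≡ g j) → ∀ i → sum g i n ≡ sum g 0 n
sum-periodic g n per zero    = refl
sum-periodic g n per (suc i) = trans
  (+-cancelˡ-≡ (g i) _ _ (trans (sum-last g i n)
    (trans (cong (sum g i n +_) (per i)) (+-comm (sum g i n) (g i)))))
  (sum-periodic g n per i)

indicator : ∀ {A : Set} → Dec A → ℕ
indicator a? = if does a? then 1 else 0

indicator-true : ∀ {A : Set} (a? : Dec A) → A → indicator a? ≡ 1
indicator-true a? a = cong (if_then 1 else 0) (dec-true a? a)

-- The start `i` and the function `g` are kept general so that the induction can remove the head of
-- `p` while the indices stay unshifted.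
sum-indicator : ∀ {n} (p : Subset n) g i →
                (∀ v → g (i + toℕ v) ≡ indicator (v ∈? p)) → sum g i n ≡ ∣ p ∣
sum-indicator []      g i eq = refl
sum-indicator (b ∷ p) g i eq
  with b | trans (cong g (sym (+-identityʳ i))) (eq zero)
     | sum-indicator p g (suc i) (λ v → trans (cong g (sym (+-suc i (toℕ v)))) (eq (suc v)))
... | inside  | gi | rest = cong₂ _+_ gi rest
... | outside | gi | rest = cong₂ _+_ gi rest

-- Both `r` and `s` contribute at most 3 and `s` strictly less, so `g * 3` stays below
-- `(2 + q) * 3`.
upper-count : ∀ q {g r s} → r ≤ 3 → s < r → g * 3 ≤ r + q * 3 + s → g ≤ suc q
upper-count q {g} {r} {s} r≤3 s<r g*3≤ = m<1+n⇒m≤n (*-cancelʳ-< 3 g (2 + q) (begin-strict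
  g * 3         ≤⟨ g*3≤ ⟩
  r + q * 3 + s <⟨ +-mono-≤-< (+-monoˡ-≤ (q * 3) r≤3) (≤-trans s<r r≤3) ⟩
  3 + q * 3 + 3 ≡⟨ +-comm (3 + q * 3) 3 ⟩
  (2 + q) * 3   ∎))
  where open ≤-Reasoning

lower-count : ∀ q {g r s} → s < r → r + q * 3 ≤ s + g * 3 → suc q ≤ g
lower-count q {g} {r} {s} s<r ≤s+g*3 = *-cancelʳ-< 3 q g (+-cancelˡ-< s (q * 3) (g * 3)
  (<-≤-trans (+-monoˡ-< (q * 3) s<r) ≤s+g*3))

-- Strong domination

∈-neighbours⁺ : ∀ {N} (G : Graph N) {u v} → Adj G v u → u ∈ neighbours G v
∈-neighbours⁺ G {u} {v} vu =
  lookup⇒[]= u _ (trans (lookup∘tabulate _ u) (dec-true (adj? G v u) vu))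

∈-neighbours⁻ : ∀ {N} (G : Graph N) {u v} → u ∈ neighbours G v → Adj G v u
∈-neighbours⁻ G {u} {v} u∈
  with adj? G v u | trans (sym (lookup∘tabulate (does ∘ adj? G v) u)) ([]=⇒lookup u∈)
... | yes vu | _ = vu

γst≤ : ∀ {N} (G : Graph N) {D} → IsStrongDominating G D → γst G ≤ ∣ D ∣
γst≤ G = proj₂ (proj₂ (γst-min G)) _

module _ {N} (G H : Graph N) (V⊆ : V G ⊆ V H) (V⊇ : V H ⊆ V G)
         (Adj⊆ : ∀ {u v} → Adj G u v → Adj H u v)
         (Adj⊇ : ∀ {u v} → Adj H u v → Adj G u v) where

  deg≤ : ∀ v → deg G v ≤ deg H v
  deg≤ v = p⊆q⇒∣p∣≤∣q∣ (∈-neighbours⁺ H ∘ Adj⊆ ∘ ∈-neighbours⁻ G)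

  deg≥ : ∀ v → deg H v ≤ deg G v
  deg≥ v = p⊆q⇒∣p∣≤∣q∣ (∈-neighbours⁺ G ∘ Adj⊇ ∘ ∈-neighbours⁻ H)

  -- Degrees agree in `G` and `H`, so a minimum strong dominating set of `G` also serves `H`. This
  -- compares graphs, such as `G -ᵍ ⊥` and `G`, that agree without being equal by definition.
  γst-antitone : γst H ≤ γst G
  γst-antitone = let D , (D⊆V , dom) , ∣D∣≡γ = proj₁ (proj₂ (γst-min G)) in subst (γst H ≤_) ∣D∣≡γ (γst≤ H
    ( V⊆ ∘ D⊆V
    , λ v v∈V v∉D → let u , u∈D , vu , d = dom v (V⊇ v∈V) v∉D in
        u , u∈D , Adj⊆ vu , ≤-trans (deg≥ v) (≤-trans d (deg≤ u))))

γst-delete-⊥ : ∀ {N} (G : Graph N) → γst (G -ᵍ ⊥) ≡ γst G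
γst-delete-⊥ G = ≤-antisym
  (γst-antitone G (G -ᵍ ⊥) V⊆ V⊇ (λ a → a , ∉⊥ , ∉⊥) proj₁)
  (γst-antitone (G -ᵍ ⊥) G V⊇ V⊆ proj₁ (λ a → a , ∉⊥ , ∉⊥))
  where
  V⊆ : V G ⊆ V G ─ ⊥
  V⊆ v∈ = x∈p∧x∉q⇒x∈p─q v∈ ∉⊥
  V⊇ : V G ─ ⊥ ⊆ V G
  V⊇ = p─q⊆p (V G) ⊥

-- The cyclic order

next-functional : ∀ {n} {u v w : Fin n} → Next u v → Next u w → v ≡ w
next-functional (inj₁ p)       (inj₁ q)       = toℕ-injective (trans (sym p) q)
next-functional {v = v} (inj₁ p) (inj₂ (q , _)) =
  contradiction (trans (sym p) q) (<⇒≢ (toℕ<n v))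
next-functional {w = w} (inj₂ (p , _)) (inj₁ q) =
  contradiction (trans (sym q) p) (<⇒≢ (toℕ<n w))
next-functional (inj₂ (_ , p)) (inj₂ (_ , q)) = toℕ-injective (trans p (sym q))

next-injective : ∀ {n} {u v w : Fin n} → Next u w → Next v w → u ≡ v
next-injective (inj₁ p)       (inj₁ q)       = toℕ-injective (suc-injective (trans p (sym q)))
next-injective (inj₁ p)       (inj₂ (_ , q)) = contradiction (trans p q) λ ()
next-injective (inj₂ (_ , p)) (inj₁ q)       = contradiction (trans q p) λ ()
next-injective (inj₂ (p , _)) (inj₂ (q , _)) = toℕ-injective (suc-injective (trans p (sym q)))

-- If neither step wraps around, then `u < v < u`; one wrap forces `n` to be 2, and two wraps force
-- it to be 1.
next²-irrefl : ∀ {n} → 3 ≤ n → {u v : Fin n} → Next u v → ¬ Next v u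
next²-irrefl _ {u} {v} (inj₁ p) (inj₁ q) =
  <-asym (subst (toℕ u <_) p ≤-refl) (subst (toℕ v <_) q ≤-refl)
next²-irrefl 3≤n (inj₁ p) (inj₂ (q , r)) =
  <⇒≢ 3≤n (trans (cong (2 +_) (sym r)) (trans (cong suc p) q))
next²-irrefl 3≤n (inj₂ (p , r)) (inj₁ q) =
  <⇒≢ 3≤n (trans (cong (2 +_) (sym r)) (trans (cong suc q) p))
next²-irrefl 3≤n (inj₂ (_ , r)) (inj₂ (q , _)) =
  <⇒≢ (≤-trans (s≤s (s≤s z≤n)) 3≤n) (trans (cong suc (sym r)) q)

module Cycle {n : ℕ} (3≤n : 3 ≤ n) where

  instance
    n-nonZero : NonZero n
    n-nonZero = >-nonZero (≤-trans (s≤s z≤n) 3≤n)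

  -- Opaque because j occurs in j mod n only under an irrelevant argument, from
  -- which unification cannot recover it.
  opaque
    at : ℕ → Fin n
    at j = j mod n

    toℕ-at : ∀ j → toℕ (at j) ≡ j % n
    toℕ-at j = toℕ-fromℕ< (m%n<n j n)

  toℕ-at-< : ∀ {j} → j < n → toℕ (at j) ≡ j
  toℕ-at-< {j} j<n = trans (toℕ-at j) (m<n⇒m%n≡m j<n)

  at-toℕ : ∀ v → at (toℕ v) ≡ v
  at-toℕ v = toℕ-injective (toℕ-at-< (toℕ<n v))

  at-periodic : ∀ j → at (n + j) ≡ at j
  at-periodic j = toℕ-injective (trans (toℕ-at (n + j))
    (trans (cong (_% n) (+-comm n j)) (trans ([m+n]%n≡m%n j n) (sym (toℕ-at j)))))

  -- The index is produced as a successor so that the predecessor `at j` can be named even for the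
  -- vertex 0; this is why one full turn is added.
  at-surjective : ∀ v → ∃ λ j → v ≡ at (suc j)
  at-surjective v = pred n + toℕ v , sym (trans
    (cong (λ m → at (m + toℕ v)) (suc-pred n)) (trans (at-periodic (toℕ v)) (at-toℕ v)))

  suc-% : ∀ j → suc j % n ≡ suc (j % n) % n
  suc-% j = trans (cong (λ m → suc m % n) (m≡m%n+[m/n]*n j n))
    ([m+kn]%n≡m%n (suc (j % n)) (j / n) n)

  at-next : ∀ j → Next (at j) (at (suc j))
  at-next j with m≤n⇒m<n∨m≡n (m%n<n j n)
  ... | inj₁ 1+r<n = inj₁ (trans (cong suc (toℕ-at j))
          (sym (trans (toℕ-at (suc j)) (trans (suc-% j) (m<n⇒m%n≡m 1+r<n)))))
  ... | inj₂ 1+r≡n = inj₂ (trans (cong suc (toℕ-at j)) 1+r≡n ,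
          trans (toℕ-at (suc j)) (trans (suc-% j) (trans (cong (_% n) 1+r≡n) (n%n≡0 n))))

  at-2+≢ : ∀ j → at (2 + j) ≢ at j
  at-2+≢ j eq = next²-irrefl 3≤n (at-next j) (subst (Next (at (suc j))) eq (at-next (suc j)))

  adj⇒pred⊎suc : ∀ j {u} → Adj (cycle n 3≤n) (at (suc j)) u → u ≡ at j ⊎ u ≡ at (2 + j)
  adj⇒pred⊎suc j (inj₁ p) = inj₂ (next-functional p (at-next (suc j)))
  adj⇒pred⊎suc j (inj₂ p) = inj₁ (next-injective p (at-next j))

  -- Counting over one turn of the cycle.

  opaque
    χ : Subset n → ℕ → ℕ
    χ p j = indicator (at j ∈? p)

    sum-χ : ∀ p i → sum (χ p) i n ≡ ∣ p ∣
    sum-χ p i = trans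
      (sum-periodic (χ p) n (λ j → cong (λ v → indicator (v ∈? p)) (at-periodic j)) i)
      (sum-indicator p (χ p) 0 (λ v → cong (λ u → indicator (u ∈? p)) (at-toℕ v)))

    1≤χ : ∀ {p j} → at j ∈ p → 1 ≤ χ p j
    1≤χ {p} {j} j∈p = ≤-reflexive (sym (indicator-true (at j ∈? p) j∈p))

  -- Deleting `S`: the lower bound on the domination number.

  module _ (S : Subset n) where

    -- Opaque so that case analysis does not unfold the deleted graph in goals.
    opaque
      H : Graph n
      H = cycle n 3≤n -ᵍ S

      γst-H : γst H ≡ γst (cycle n 3≤n -ᵍ S)
      γst-H = cong γst {H} {cycle n 3≤n -ᵍ S} refl

      ∈V⁺ : ∀ {v} → v ∉ S → v ∈ V H
      ∈V⁺ = x∈p∧x∉q⇒x∈p─q ∈⊤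

      ∈V⁻ : ∀ {v} → v ∈ V H → v ∉ S
      ∈V⁻ = x∈p─q⇒x∉q ⊤ S

      adj⁺ : ∀ {u v} → Adj (cycle n 3≤n) u v → u ∉ S → v ∉ S → Adj H u v
      adj⁺ uv u∉S v∉S = uv , u∉S , v∉S

      adj⁻ : ∀ {u v} → Adj H u v → Adj (cycle n 3≤n) u v × u ∉ S × v ∉ S
      adj⁻ uv = uv

    Dominated : Subset n → Fin n → Set
    Dominated D v = v ∈ D ⊎ ∃ λ u → u ∈ D × Adj H v u × deg H v ≤ deg H u

    -- Every vertex j+1 outside S has one of j, j+1, j+2 in D; now sum over a period.
    n≤∣S∣+∣D∣*3 : ∀ {D} → IsStrongDominating H D → n ≤ ∣ S ∣ + ∣ D ∣ * 3
    n≤∣S∣+∣D∣*3 {D} (_ , dom) = ≤-trans (summed n 0) (≤-reflexive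
      (cong₂ _+_ (sum-χ S 1) (trans
        (cong₂ _+_ (sum-χ D 0) (cong₂ _+_ (sum-χ D 1) (sum-χ D 2))) (triple≡*3 ∣ D ∣))))
      where
      triple≡*3 : ∀ d → d + (d + d) ≡ d * 3
      triple≡*3 = solve-∀

      into : ∀ j {m} → 1 ≤ m → 1 ≤ χ S (1 + j) + m
      into j 1≤m = ≤-trans 1≤m (m≤n+m _ (χ S (1 + j)))

      counted : ∀ j → 1 ≤ χ S (1 + j) + (χ D j + (χ D (1 + j) + χ D (2 + j)))
      counted j with at (1 + j) ∈? S
      ... | yes v∈S = ≤-trans (1≤χ v∈S) (m≤m+n _ _)
      ... | no v∉S with at (1 + j) ∈? D
      ...   | yes v∈D = into j (≤-trans (1≤χ v∈D) (≤-trans (m≤m+n _ _) (m≤n+m _ (χ D j))))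
      ...   | no v∉D with dom _ (∈V⁺ v∉S) v∉D
      ...     | u , u∈D , vu , _ with adj⇒pred⊎suc j (proj₁ (adj⁻ vu))
      ...       | inj₁ refl = into j (≤-trans (1≤χ u∈D) (m≤m+n _ _))
      ...       | inj₂ refl = into j (≤-trans (1≤χ u∈D)
                      (≤-trans (m≤n+m _ (χ D (1 + j))) (m≤n+m _ (χ D j))))

      rearrange : ∀ s a b c s′ a′ b′ c′ →
        (s + (a + (b + c))) + (s′ + (a′ + (b′ + c′))) ≡
        (s + s′) + ((a + a′) + ((b + b′) + (c + c′)))
      rearrange = solve-∀

      summed : ∀ m i → m ≤ sum (χ S) (1 + i) m
        + (sum (χ D) i m + (sum (χ D) (1 + i) m + sum (χ D) (2 + i) m))
      summed zero    i = z≤n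
      summed (suc m) i = ≤-trans (+-mono-≤ (counted i) (summed m (suc i)))
        (≤-reflexive (rearrange (χ S (1 + i)) (χ D i) (χ D (1 + i)) (χ D (2 + i)) _ _ _ _))

    n≤∣S∣+γst*3 : n ≤ ∣ S ∣ + γst H * 3
    n≤∣S∣+γst*3 = let D , sd , ∣D∣≡γ = proj₁ (proj₂ (γst-min H)) in
      subst (λ d → n ≤ ∣ S ∣ + d * 3) ∣D∣≡γ (n≤∣S∣+∣D∣*3 sd)

    -- Degrees after deletion.

    deg≤2 : ∀ v → deg H v ≤ 2
    deg≤2 v with at-surjective v
    ... | j , refl = ≤-trans
      (p⊆q⇒∣p∣≤∣q∣ {q = ⁅ at j ⁆ ∪ ⁅ at (2 + j) ⁆} λ u∈ →
        [ (λ { refl → x∈p∪q⁺ (inj₁ (x∈⁅x⁆ _)) })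
        , (λ { refl → x∈p∪q⁺ (inj₂ (x∈⁅x⁆ _)) }) ]′
        (adj⇒pred⊎suc j (proj₁ (adj⁻ (∈-neighbours⁻ H u∈)))))
      (≤-trans (∣⁅x⁆∪p∣≤1+∣p∣ (at j) ⁅ at (2 + j) ⁆) (≤-reflexive (cong suc (∣⁅x⁆∣≡1 (at (2 + j))))))

    deg≤1 : ∀ j → at (2 + j) ∈ S → deg H (at (suc j)) ≤ 1
    deg≤1 j s∈S = ≤-trans
      (p⊆q⇒∣p∣≤∣q∣ {q = ⁅ at j ⁆} λ u∈ →
        let a , _ , u∉S = adj⁻ (∈-neighbours⁻ H u∈) in
        [ (λ { refl → x∈⁅x⁆ _ }) , (λ { refl → contradiction s∈S u∉S }) ]′ (adj⇒pred⊎suc j a))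
      (≤-reflexive (∣⁅x⁆∣≡1 (at j)))

    adj-suc : ∀ {j} → at j ∉ S → at (suc j) ∉ S → Adj H (at j) (at (suc j))
    adj-suc {j} = adj⁺ (inj₁ (at-next j))

    2≤deg : ∀ {j} → at j ∉ S → at (1 + j) ∉ S → at (2 + j) ∉ S → 2 ≤ deg H (at (1 + j))
    2≤deg {j} p q r = x≢y⇒2≤∣p∣ (∈-neighbours⁺ H (adj-suc q r))
      (∈-neighbours⁺ H (adj-sym H (adj-suc p q))) (at-2+≢ j)

    -- Covering arcs by blocks: the upper bound.

    Covered : Subset n → ℕ → ℕ → Set
    Covered D i e = ∀ {j} → i ≤ j → j < e → at j ∉ S → Dominated D (at j)

    -- A partial dominating set for the arc of indices from `i` up to, but excluding, `e`. Bounding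
    -- three times its size makes each block cost exactly 3 and avoids division.
    record Cover (i e K : ℕ) : Set where
      constructor mkCover
      field
        D        : Subset n
        disjoint : ∀ {v} → v ∈ D → v ∉ S
        covered  : Covered D i e
        bound    : ∣ D ∣ * 3 ≤ K

    weaken : ∀ {i e K L} → K ≤ L → Cover i e K → Cover i e L
    weaken K≤L (mkCover D d c b) = mkCover D d c (≤-trans b K≤L)

    -- An arc of `n` indices starting at `i` meets every vertex `v`: at `toℕ v` if that is at least
    -- `i`, and at `n + toℕ v` otherwise.
    γst*3≤ : ∀ {i K} → i ≤ n → Cover i (i + n) K → γst H * 3 ≤ K
    γst*3≤ {i} i≤n (mkCover D disjoint covered bound) =
      ≤-trans (*-monoˡ-≤ 3 (γst≤ H (∈V⁺ ∘ disjoint , dom))) bound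
      where
      dominated : ∀ v → v ∉ S → Dominated D v
      dominated v v∉S with i ≤? toℕ v
      ... | yes i≤v = subst (Dominated D) (at-toℕ v)
              (covered i≤v (≤-trans (toℕ<n v) (m≤n+m n i)) (v∉S ∘ subst (_∈ S) (at-toℕ v)))
      ... | no i≰v = subst (Dominated D) eq
              (covered (≤-trans i≤n (m≤m+n n (toℕ v)))
                (subst (n + toℕ v <_) (+-comm n i) (+-monoʳ-< n (≰⇒> i≰v)))
                (v∉S ∘ subst (_∈ S) eq))
        where eq = trans (at-periodic (toℕ v)) (at-toℕ v)

      dom : ∀ v → v ∈ V H → v ∉ D → ∃ λ u → u ∈ D × Adj H v u × deg H v ≤ deg H u
      dom v v∈V v∉D =
        [ (λ v∈D → contradiction v∈D v∉D) , (λ x → x) ]′ (dominated v (∈V⁻ v∈V))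

    peel : ∀ {D i e} → (at i ∉ S → Dominated D (at i)) → Covered D (suc i) e → Covered D i e
    peel dom covered i≤j j<e with m≤n⇒m<n∨m≡n i≤j
    ... | inj₁ i<j  = covered i<j j<e
    ... | inj₂ refl = dom

    done : ∀ {i e K} → e ≤ i → Cover i e K
    done {K = K} e≤i = mkCover ⊥ (λ v∈⊥ → contradiction v∈⊥ ∉⊥)
      (λ i≤j j<e → contradiction (≤-trans j<e (≤-trans e≤i i≤j)) (<-irrefl refl))
      (subst (λ m → m * 3 ≤ K) (sym (∣⊥∣≡0 n)) z≤n)

    skip : ∀ {i e K} → at i ∈ S → Cover (suc i) e K → Cover i e K
    skip i∈S (mkCover D d c b) = mkCover D d (peel (contradiction i∈S) c) b

    -- The common part of all blocks: `u` costs 3, and `extend` says which indices before `i′` it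
    -- dominates. What was dominated stays so, since degrees refer to `H` and not to the chosen set.
    insert : ∀ {i i′ e K} u → u ∉ S →
             (∀ {D} → u ∈ D → Covered D i′ e → Covered D i e) →
             Cover i′ e K → Cover i e (3 + K)
    insert {i′ = i′} {e} u u∉S extend (mkCover D disjoint covered bound) = mkCover (⁅ u ⁆ ∪ D)
      ([ (λ v∈ → subst (_∉ S) (sym (x∈⁅y⁆⇒x≡y u v∈)) u∉S) , disjoint ]′ ∘ x∈p∪q⁻ ⁅ u ⁆ D)
      (extend (p⊆p∪q D (x∈⁅x⁆ u)) covered′)
      (≤-trans (*-monoˡ-≤ 3 (∣⁅x⁆∪p∣≤1+∣p∣ u D)) (+-monoʳ-≤ 3 bound))
      where
      covered′ : Covered (⁅ u ⁆ ∪ D) i′ e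
      covered′ i≤j j<e j∉S =
        [ inj₁ ∘ q⊆p∪q ⁅ u ⁆ D
        , (λ (w , w∈D , a) → inj₂ (w , q⊆p∪q ⁅ u ⁆ D w∈D , a)) ]′ (covered i≤j j<e j∉S)

    single : ∀ {i e K} → at i ∉ S → Cover (1 + i) e K → Cover i e (3 + K)
    single {i} i∉S = insert (at i) i∉S λ u∈D → peel (λ _ → inj₁ u∈D)

    -- The vertex at 1 + i has degree 1, hence the one at i dominates it whatever
    -- precedes the block.
    pair : ∀ {i e K} → at i ∉ S → at (1 + i) ∉ S → at (2 + i) ∈ S →
           Cover (2 + i) e K → Cover i e (3 + K)
    pair {i} p q r∈S = insert (at i) p λ u∈D →
      peel (λ _ → inj₁ u∈D) ∘
      peel (λ _ → inj₂ (at i , u∈D , adj-sym H (adj-suc p q) ,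
        ≤-trans (deg≤1 i r∈S) (x∈p⇒1≤∣p∣ (∈-neighbours⁺ H (adj-suc p q)))))

    -- The middle vertex keeps both neighbours, so it has the largest possible degree 2 and
    -- dominates them whatever their degrees are.
    triple : ∀ {i e K} → at i ∉ S → at (1 + i) ∉ S → at (2 + i) ∉ S →
             Cover (3 + i) e K → Cover i e (3 + K)
    triple {i} p q r = insert (at (1 + i)) q λ u∈D →
      peel (λ _ → inj₂ (_ , u∈D , adj-suc p q , ≤-trans (deg≤2 _) (2≤deg p q r))) ∘
      peel (λ _ → inj₁ u∈D) ∘
      peel (λ _ → inj₂ (_ , u∈D , adj-sym H (adj-suc q r) , ≤-trans (deg≤2 _) (2≤deg p q r)))

    -- The last block may overrun `e`, so the length of the arc need not be a multiple of 3.
    triples : ∀ q {i e} → e ≤ q * 3 + i → (∀ {j} → i ≤ j → j < q * 3 + i → at j ∉ S) →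
              Cover i e (q * 3)
    triples zero    e≤ free = done e≤
    triples (suc q) {i} {e} e≤ free = triple
      (free ≤-refl (s≤s (m≤n+m i (2 + q * 3))))
      (free (n≤1+n i) (s≤s (s≤s (m≤n+m i (1 + q * 3)))))
      (free (m≤n+m i 2) (s≤s (s≤s (s≤s (m≤n+m i (q * 3))))))
      (triples q (subst (e ≤_) eq e≤)
        (λ {j} 3+i≤j j< → free (≤-trans (m≤n+m i 3) 3+i≤j) (subst (j <_) (sym eq) j<)))
      where
      shift : ∀ x y → 3 + x + y ≡ x + (3 + y)
      shift = solve-∀
      eq : suc q * 3 + i ≡ q * 3 + (3 + i)
      eq = shift (q * 3) i

    -- A block of one or two vertices is followed by a vertex of S: the term of the sum
    -- at that vertex makes up for the missing vertices of the block.
    greedy : ∀ {e} → at e ∈ S → ∀ m {i} → m + i ≡ suc e → Cover i (suc e) (m + sum (χ S) i m)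
    greedy e∈S zero    refl = done ≤-refl
    greedy e∈S (suc m) {i} eq with at i ∈? S
    ... | yes i∈S = skip i∈S (weaken (+-mono-≤ (n≤1+n m) (m≤n+m _ (χ S i)))
                      (greedy e∈S m (trans (+-suc m i) eq)))
    -- The last index of the arc is `e`, whose vertex is in `S`, so a run of surviving vertices
    -- always ends inside the arc.
    greedy e∈S (suc zero) refl | no i∉S = contradiction e∈S i∉S
    greedy e∈S (suc (suc m)) {i} eq | no i∉S with at (1 + i) ∈? S
    ... | yes 1+i∈S = weaken (bound m (χ S i) (1≤χ 1+i∈S))
            (single i∉S (skip 1+i∈S (greedy e∈S m (trans (shift m i) eq))))
      where
      shift : ∀ m i → m + (2 + i) ≡ 2 + (m + i)
      shift = solve-∀
      bound : ∀ m a {b c} → 1 ≤ b → 3 + (m + c) ≤ 2 + (m + (a + (b + c)))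
      bound m a {b} {c} 1≤b = s≤s (s≤s (≤-trans (≤-reflexive (sym (+-suc m c)))
        (+-monoʳ-≤ m (≤-trans (+-monoˡ-≤ c 1≤b) (m≤n+m (b + c) a)))))
    greedy e∈S (suc (suc zero)) refl | no i∉S | no 1+i∉S = contradiction e∈S 1+i∉S
    greedy e∈S (suc (suc (suc m))) {i} eq | no i∉S | no 1+i∉S =
      weaken (bound (χ S i) (χ S (1 + i)) (χ S (2 + i))) block
      where
      shift : ∀ m i → m + (3 + i) ≡ 3 + (m + i)
      shift = solve-∀
      bound : ∀ a b c {d} → 3 + (m + d) ≤ 3 + (m + (a + (b + (c + d))))
      bound a b c {d} = +-monoʳ-≤ 3 (+-monoʳ-≤ m
        (≤-trans (m≤n+m d c) (≤-trans (m≤n+m (c + d) b) (m≤n+m _ a))))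
      -- Either block consumes three indices: after a pair, the third is the deleted vertex.
      rest = greedy e∈S m (trans (shift m i) eq)
      block : Cover i _ (3 + (m + sum (χ S) (3 + i) m))
      block with at (2 + i) ∈? S
      ... | yes 2+i∈S = pair i∉S 1+i∉S 2+i∈S (skip 2+i∈S rest)
      ... | no 2+i∉S  = triple i∉S 1+i∉S 2+i∉S rest

    -- The arc starts just after `v` and ends at `n + toℕ v`, which is `v` again; this gives
    -- `greedy` its deleted endpoint.
    γst*3≤n+∣S∣ : ∀ {v} → v ∈ S → γst H * 3 ≤ n + ∣ S ∣
    γst*3≤n+∣S∣ {v} v∈S = subst (λ m → γst H * 3 ≤ n + m) (sum-χ S (suc (toℕ v)))
      (γst*3≤ (toℕ<n v) (subst
        (λ e → Cover (suc (toℕ v)) (suc e) (n + sum (χ S) (suc (toℕ v)) n)) (+-comm n (toℕ v))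
        (greedy (subst (_∈ S) (sym (trans (at-periodic (toℕ v)) (at-toℕ v))) v∈S) n
          (+-suc n (toℕ v)))))

    γst≤1+q : ∀ q {r} → n ≡ r + q * 3 → r ≤ 3 → ∣ S ∣ < r → γst H ≤ suc q
    γst≤1+q q {r} n≡ r≤3 ∣S∣<r = by-cases (nonempty? S)
      where
      by-cases : Dec (Nonempty S) → γst H ≤ suc q
      by-cases (yes (v , v∈S)) = upper-count q r≤3 ∣S∣<r
        (subst (λ m → γst H * 3 ≤ m + ∣ S ∣) n≡ (γst*3≤n+∣S∣ v∈S))
      -- With nothing deleted there is no endpoint for `greedy`, but `suc q` triples go all the way
      -- round; they overrun by `3 - r` indices, which only makes blocks overlap.
      by-cases (no empty) = *-cancelʳ-≤ (γst H) (suc q) 3 (γst*3≤ z≤n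
        (triples (suc q) (≤-trans (≤-reflexive n≡)
            (≤-trans (+-monoˡ-≤ (q * 3) r≤3) (m≤m+n (suc q * 3) 0)))
          (λ _ _ j∈S → empty (_ , j∈S))))

    1+q≤γst : ∀ q {r} → n ≡ r + q * 3 → ∣ S ∣ < r → suc q ≤ γst H
    1+q≤γst q n≡ ∣S∣<r = lower-count q ∣S∣<r (subst (_≤ ∣ S ∣ + γst H * 3) n≡ n≤∣S∣+γst*3)

    γst≡1+q : ∀ q {r} → n ≡ r + q * 3 → r ≤ 3 → ∣ S ∣ < r → γst H ≡ suc q
    γst≡1+q q n≡ r≤3 ∣S∣<r = ≤-antisym (γst≤1+q q n≡ r≤3 ∣S∣<r) (1+q≤γst q n≡ ∣S∣<r)

  -- Deleting `r` consecutive vertices, and the stability.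

  γst-delete-initial : ∀ q {r} → n ≡ r + q * 3 → γst (H (initial r)) ≤ q
  γst-delete-initial q {r} n≡ = *-cancelʳ-≤ (γst (H (initial r))) q 3
    (γst*3≤ (initial r) z≤n cover)
    where
    n≡q*3+r : n ≡ q * 3 + r
    n≡q*3+r = trans n≡ (+-comm r (q * 3))

    -- The surviving path occupies the indices from `r` to `n - 1`, which is exactly `q` triples.
    after : Cover (initial r) r n (q * 3)
    after = triples (initial r) q (≤-reflexive n≡q*3+r) λ {j} r≤j j< j∈ →
      <⇒≱ (subst (_< r) (toℕ-at-< (subst (j <_) (sym n≡q*3+r) j<)) (∈-initial⁻ j∈)) r≤j

    before : ∀ {D} → Covered (initial r) D r n → Covered (initial r) D 0 n
    before covered {j} _ j<n j∉ with r ≤? j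
    ... | yes r≤j = covered r≤j j<n j∉
    ... | no r≰j  = contradiction
          (∈-initial⁺ (subst (_< r) (sym (toℕ-at-< j<n)) (≰⇒> r≰j))) j∉

    cover : Cover (initial r) 0 n (q * 3)
    cover = let mkCover D disjoint covered bound = after in mkCover D disjoint (before covered) bound

  st≡ : ∀ q {r} → n ≡ r + q * 3 → 1 ≤ r → r ≤ 3 → st (cycle n 3≤n) (cycle-nonempty n 3≤n) ≡ r
  st≡ q {r} n≡ 1≤r r≤3 = ≤-antisym st≤r r≤st
    where
    γst-delete≡1+q : ∀ S → ∣ S ∣ < r → γst (cycle n 3≤n -ᵍ S) ≡ suc q
    γst-delete≡1+q S ∣S∣<r = trans (sym (γst-H S)) (γst≡1+q S q n≡ r≤3 ∣S∣<r)

    -- The cycle itself is the case `S = ⊥`, which has fewer than `r` elements because `1 ≤ r`.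
    γC≡1+q : γst (cycle n 3≤n) ≡ suc q
    γC≡1+q = trans (sym (γst-delete-⊥ (cycle n 3≤n)))
      (γst-delete≡1+q ⊥ (subst (_< r) (sym (∣⊥∣≡0 n)) 1≤r))

    st≤r : st (cycle n 3≤n) (cycle-nonempty n 3≤n) ≤ r
    st≤r = ≤-trans
      (proj₂ (proj₂ (st-min (cycle n 3≤n) (cycle-nonempty n 3≤n))) (initial r)
        ( (λ _ → ∈⊤)
        , λ eq → 1+n≰n (subst (_≤ q) (trans (γst-H (initial r)) (trans eq γC≡1+q))
                         (γst-delete-initial q n≡))))
      (∣initial∣≤ r {n})

    r≤st : r ≤ st (cycle n 3≤n) (cycle-nonempty n 3≤n)
    r≤st = let (S , (_ , γ≢) , ∣S∣≡st) , _ = proj₂ (st-min (cycle n 3≤n) (cycle-nonempty n 3≤n)) in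
      ≮⇒≥ λ st<r →
        γ≢ (trans (γst-delete≡1+q S (subst (_< r) (sym ∣S∣≡st) st<r)) (sym γC≡1+q))

proposition2p3 : (n : ℕ) (3≤n : 3 ≤ n) →
    (n % 3 ≡ 1 → st (cycle n 3≤n) (cycle-nonempty n 3≤n) ≡ 1) ×
    (n % 3 ≡ 2 → st (cycle n 3≤n) (cycle-nonempty n 3≤n) ≡ 2) ×
    (n % 3 ≡ 0 → st (cycle n 3≤n) (cycle-nonempty n 3≤n) ≡ 3)
proposition2p3 n 3≤n =
    (λ n%3≡1 → st≡ (n / 3) {1} (split n%3≡1) ≤-refl (s≤s z≤n))
  , (λ n%3≡2 → st≡ (n / 3) {2} (split n%3≡2) (s≤s z≤n) (s≤s (s≤s z≤n)))
  , (λ n%3≡0 → multiple (n / 3) (split n%3≡0))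
  where
  open Cycle 3≤n using (st≡)

  split : ∀ {r} → n % 3 ≡ r → n ≡ r + (n / 3) * 3
  split n%3≡r = trans (m≡m%n+[m/n]*n n 3) (cong (_+ (n / 3) * 3) n%3≡r)

  -- Remainder 0 corresponds to `r = 3`: one 3 is taken out of the quotient, which is positive since
  -- `3 ≤ n`.
  multiple : ∀ q → n ≡ q * 3 → st (cycle n 3≤n) (cycle-nonempty n 3≤n) ≡ 3
  multiple zero    n≡0 = contradiction (subst (3 ≤_) n≡0 3≤n) λ ()
  multiple (suc q) n≡  = st≡ q {3} n≡ (s≤s z≤n) ≤-refl
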